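{- $\mathrm{Fin}(6)=\mathrm{Adm}(6)$.
   Context: $K_4-e$ is the graph on four vertices $a,b,c,d$ with edges $ab,ac,ad,bc,bd$; it is denoted $[a,b,c-d]$. A $(K_4-e)$-design of order $v$ is a pair $(X,\mathcal B)$ where $X$ is a set of $v$ vertices and $\mathcal B$ is a collection of copies of $K_4-e$ (blocks) with vertices in $X$ whose edge sets partition the edges of $K_v$ on $X$; it has $b_v=v(v-1)/10$ blocks. For a graph $B$, $T(B)$ is the set of its triangles (3-vertex subsets inducing a triangle); e.g. $T([a,b,c-d])=\{\{a,b,c\},\{a,b,d\}\}$, and $T(\mathcal B)=\bigcup_{B\in\mathcal B}T(B)$. Two designs $(X,\mathcal B_1),(X,\mathcal B_2)$ on the same vertex set intersect in $s$ blocks if $|\mathcal B_1\cap\mathcal B_2|=s$, and in $t$ triangles if $|T(\mathcal B_1)\cap T(\mathcal B_2)|=t$. Define $\mathrm{Fin}(v)=\{(s,t):$ there exists a pair of $(K_4-e)$-designs of order $v$ on the same vertex set intersecting in $s$ blocks and $t+2s$ triangles$\}$; $J(v)=\{s:$ there is a pair of $(K_4-e)$-designs of order $v$ intersecting in $s$ blocks$\}$; $J_T(v)=\{t:$ there is a pair of $(K_4-e)$-designs of order $v$ intersecting in $t$ triangles$\}$; and $\mathrm{Adm}(v)=\{(s,t): s,t\ge 0,\ s+t\le b_v,\ s\in J(v),\ t+2s\in J_T(v)\}$. (Known from the literature: $J(6)=\{0,3\}$ and $J_T(6)=\{0,2,3,6\}$, so $\mathrm{Adm}(6)=\{(0,0),(0,2),(0,3),(3,0)\}$.)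 -}

module Defs where

open import Data.Nat using (ℕ; _+_; _*_; _∸_; _≤_)
open import Data.Nat.DivMod using (_/_)
open import Data.Fin using (Fin)
open import Data.Fin.Subset using (Subset; ∣_∣) renaming (_∈_ to _∈ₛ_)
open import Data.List using (List; []; _∷_; length)
open import Data.List.Membership.Propositional using (_∈_)
open import Data.List.Relation.Unary.All using (All)
open import Data.List.Relation.Unary.Unique.Propositional using (Unique)
open import Data.Product using (_×_; _,_; ∃-syntax; ∃!)
open import Data.Sum using (_⊎_)
open import Data.Vec using (Vec; lookup)
open import Function.Bundles using (_⇔_)
open import Level using (0ℓ)
open import Relation.Binary.PropositionalEquality using (_≡_; _≢_)
open import Relation.Nullary using (¬_)
open import Relation.Unary using (Pred; _∩_)

-- Finite sets are predicates; P has n elements when it is enumerated by a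
-- duplicate-free list of length n.
HasCard : {A : Set} → Pred A 0ℓ → ℕ → Set
HasCard {A} P n =
  ∃[ xs ] Unique xs × length xs ≡ n × ((x : A) → x ∈ xs ⇔ P x)

-- Row x of the adjacency matrix is the neighbourhood of x.  As the proof
-- fields are irrelevant, _≡_ on graphs is equality of edge sets.
record Graph (v : ℕ) : Set where
  field
    neighbours : Vec (Subset v) v

  Adj : Fin v → Fin v → Set
  Adj x y = y ∈ₛ lookup neighbours x

  field
    .symmetric : ∀ x y → Adj x y → Adj y x
    .loopless  : ∀ x → ¬ Adj x x

open Graph public using (Adj)

K₄-e-edges : {V : Set} → V → V → V → V → List (V × V)
K₄-e-edges a b c d = (a , b) ∷ (a , c) ∷ (a , d) ∷ (b , c) ∷ (b , d) ∷ []

-- G is the block [a, b, c-d].  Graphs here live on all of Fin v, so the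
-- vertices outside the copy are isolated; since K₄-e has no isolated vertex,
-- distinct copies are still distinct as graphs.
record IsBlockOn {v : ℕ} (G : Graph v) (a b c d : Fin v) : Set where
  field
    distinct  : Unique (a ∷ b ∷ c ∷ d ∷ [])
    adjacency : ∀ x y →
      Adj G x y ⇔ ((x , y) ∈ K₄-e-edges a b c d ⊎ (y , x) ∈ K₄-e-edges a b c d)

IsK₄-e : {v : ℕ} → Graph v → Set
IsK₄-e G = ∃[ a ] ∃[ b ] ∃[ c ] ∃[ d ] IsBlockOn G a b c d

T : {v : ℕ} → Graph v → Pred (Subset v) 0ℓ
T G p = ∣ p ∣ ≡ 3 × (∀ x y → x ∈ₛ p → y ∈ₛ p → x ≢ y → Adj G x y)

-- A (K₄-e)-design of order v, with vertex set Fin v.  The list of blocks is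
-- duplicate-free and stands for the set of its members.
record Design (v : ℕ) : Set where
  field
    blocks    : List (Graph v)
    unique    : Unique blocks
    copies    : All IsK₄-e blocks
    partition : ∀ x y → x ≢ y → ∃! _≡_ (λ B → B ∈ blocks × Adj B x y)

  Blocks : Pred (Graph v) 0ℓ
  Blocks B = B ∈ blocks

  Triangles : Pred (Subset v) 0ℓ
  Triangles p = ∃[ B ] B ∈ blocks × T B p

open Design public using (Blocks; Triangles)

IntersectInBlocks : {v : ℕ} → Design v → Design v → ℕ → Set
IntersectInBlocks D₁ D₂ s = HasCard (Blocks D₁ ∩ Blocks D₂) s

IntersectInTriangles : {v : ℕ} → Design v → Design v → ℕ → Set
IntersectInTriangles D₁ D₂ t = HasCard (Triangles D₁ ∩ Triangles D₂) t

b : ℕ → ℕ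
b v = v * (v ∸ 1) / 10

J : ℕ → Pred ℕ 0ℓ
J v s = ∃[ D₁ ] ∃[ D₂ ] IntersectInBlocks {v} D₁ D₂ s

J-T : ℕ → Pred ℕ 0ℓ
J-T v t = ∃[ D₁ ] ∃[ D₂ ] IntersectInTriangles {v} D₁ D₂ t

-- The set Fin(v), renamed because of the clash with Data.Fin.
FineInt : ℕ → Pred (ℕ × ℕ) 0ℓ
FineInt v (s , t) =
  ∃[ D₁ ] ∃[ D₂ ] IntersectInBlocks {v} D₁ D₂ s
                × IntersectInTriangles D₁ D₂ (t + 2 * s)

Adm : ℕ → Pred (ℕ × ℕ) 0ℓ
Adm v (s , t) = s + t ≤ b v × J v s × J-T v (t + 2 * s)

{-# OPTIONS --safe #-}
module Submission where

-- For a design of order 6, the block through a given pair is one of finitely many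
-- copies of K₄-e, so an exact-cover search over the pairs, in which every next block is
-- edge-disjoint from those already chosen, meets the block set of every design.  Comparing
-- all pairs of block sets found shows that (number of common blocks, number of common
-- triangles) is always (0,0), (0,2), (0,3) or (3,6).  Hence J(6) ⊆ {0,3} and
-- J_T(6) ⊆ {0,2,3,6}, and the bound s + t ≤ 3 excludes the rest; four explicit pairs of
-- designs realise what remains.

open import Data.Bool using (true; false; if_then_else_)
open import Data.Bool.Properties using () renaming (_≟_ to _≟ᵇ_)
open import Data.Empty using (⊥-elim-irr)
open import Data.Fin using (Fin; #_)
open import Data.Fin.Properties using (_≟_; all?)
open import Data.Fin.Subset using (Subset; ∣_∣) renaming (_∈_ to _∈ₛ_)
open import Data.Fin.Subset.Properties using (⊆-antisym) renaming (_∈?_ to _∈ₛ?_)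
open import Data.List
  using (List; []; _∷_; length; map; filter; concatMap; deduplicate; allFin; cartesianProduct;
         cartesianProductWith)
import Data.List.Membership.DecPropositional as DecMembership
open import Data.List.Membership.Propositional using (_∈_; lose; find)
open import Data.List.Membership.Propositional.Properties
  using (∈-filter⁺; ∈-filter⁻; ∈-map⁺; ∈-allFin; ∈-cartesianProduct⁺; ∈-cartesianProductWith⁺;
         ∈-concatMap⁺; ∈-deduplicate⁺)
open import Data.List.Membership.Propositional.Properties.WithK using (unique∧set⇒bag)
open import Data.List.Relation.Binary.BagAndSetEquality using (∼bag⇒↭)
open import Data.List.Relation.Binary.Permutation.Propositional.Properties using (↭-length)
open import Data.List.Relation.Binary.Subset.Propositional using (_⊆_)
open import Data.List.Relation.Binary.Subset.Propositional.Properties using (Any-resp-⊆)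
open import Data.List.Relation.Unary.All as All using (All; []; _∷_)
open import Data.List.Relation.Unary.All.Properties using (all-filter; concat⁺; map⁺)
open import Data.List.Relation.Unary.AllPairs as AllPairs using ([]; _∷_)
open import Data.List.Relation.Unary.Any as Any using (Any; here; there)
import Data.List.Relation.Unary.Unique.DecPropositional as DecUnique
open import Data.List.Relation.Unary.Unique.Propositional using (Unique)
import Data.List.Relation.Unary.Unique.Propositional.Properties as Unique
open import Data.Nat using (ℕ; zero; suc; _+_; _*_; _≤_; s≤s)
open import Data.Nat.Properties using (_≤?_; +-cancelʳ-≤; +-assoc) renaming (_≟_ to _≟ⁿ_)
open import Data.Product using (_×_; _,_; ∃-syntax; ∃!; proj₁; proj₂; uncurry)
open import Data.Product.Properties using () renaming (≡-dec to ×-≡-dec)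
open import Data.Sum as Sum using (_⊎_; inj₁; swap; reduce)
open import Data.Vec using (Vec; []; _∷_; lookup; tabulate)
open import Data.Vec.Properties
  using (≡-dec; ∷-injective; lookup∘tabulate; tabulate∘lookup; tabulate-cong; []=⇒lookup;
         lookup⇒[]=)
open import Function using (_∘_; id)
open import Function.Bundles using (_⇔_; mk⇔; Equivalence)
open import Function.Construct.Identity using (⇔-id)
open import Level using (0ℓ)
open import Relation.Binary.Definitions using (DecidableEquality)
open import Relation.Binary.PropositionalEquality using (_≡_; _≢_; refl; sym; trans; cong; subst)
open import Relation.Nullary
  using (¬_; Dec; does; yes; no; contradiction; ¬?; _×-dec_; _⊎-dec_; _→-dec_)
open import Relation.Nullary.Decidable using (map′; from-yes; from-no; True; toWitness; dec-true)
open import Relation.Unary using (Pred; Decidable; _∩_; _≐_)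
open import Defs

open Equivalence

-- Cardinalities of finite sets and of their intersections

HasCard-unique : {A : Set} {P : Pred A 0ℓ} {m n : ℕ} → HasCard P m → HasCard P n → m ≡ n
HasCard-unique (_ , u , refl , xs⇔P) (_ , u′ , refl , ys⇔P) =
  -- Duplicate-free lists with the same members are permutations of each other.
  ↭-length (∼bag⇒↭ (unique∧set⇒bag u u′
    (λ {x} → mk⇔ (from (ys⇔P x) ∘ to (xs⇔P x)) (from (xs⇔P x) ∘ to (ys⇔P x)))))

module _ {A : Set} (_≟ᴬ_ : DecidableEquality A) where
  open DecMembership _≟ᴬ_ using (_∈?_)

  common : List A → List A → ℕ
  common xs ys = length (filter (_∈? ys) xs)

  HasCard-∩ : {P Q : Pred A 0ℓ} {xs ys : List A} → Unique xs →
              (∀ x → x ∈ xs ⇔ P x) → (∀ x → x ∈ ys ⇔ Q x) →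
              HasCard (P ∩ Q) (common xs ys)
  HasCard-∩ {xs = xs} {ys} u xs⇔P ys⇔Q =
    filter (_∈? ys) xs , Unique.filter⁺ (_∈? ys) u , refl , λ x → mk⇔
      (λ x∈ → let (x∈xs , x∈ys) = ∈-filter⁻ (_∈? ys) {xs = xs} x∈ in
              to (xs⇔P x) x∈xs , to (ys⇔Q x) x∈ys)
      (λ (px , qx) → ∈-filter⁺ (_∈? ys) (from (xs⇔P x) px) (from (ys⇔Q x) qx))

-- Enumeration of subsets

subsets : ∀ n → List (Subset n)
subsets zero    = [] ∷ []
subsets (suc n) = cartesianProductWith _∷_ (true ∷ false ∷ []) (subsets n)

∈-subsets : ∀ {n} (p : Subset n) → p ∈ subsets n
∈-subsets []          = here refl
∈-subsets (true  ∷ p) = ∈-cartesianProductWith⁺ _∷_ {xs = true ∷ false ∷ []} (here refl) (∈-subsets p)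
∈-subsets (false ∷ p) = ∈-cartesianProductWith⁺ _∷_ {xs = true ∷ false ∷ []} (there (here refl)) (∈-subsets p)

subsets-unique : ∀ n → Unique (subsets n)
subsets-unique zero    = [] ∷ []
subsets-unique (suc n) =
  Unique.cartesianProductWith⁺ _∷_ ∷-injective
    (((λ ()) ∷ []) ∷ [] ∷ []) (subsets-unique n)

_≟ˢ_ : ∀ {n} → DecidableEquality (Subset n)
_≟ˢ_ = ≡-dec _≟ᵇ_

-- Trades unique existence for a count, which evaluation can check on an explicit list.
unique-filter⇒∃! : {A : Set} {P : Pred A 0ℓ} (P? : Decidable P) (xs : List A) →
                   length (filter P? xs) ≡ 1 → ∃! _≡_ (λ x → x ∈ xs × P x)
unique-filter⇒∃! P? xs len with filter P? xs in eq
... | x ∷ [] =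
  x , ∈-filter⁻ P? {xs = xs} (subst (x ∈_) (sym eq) (here refl)) , λ (y∈xs , py) →
    sym (∈-singleton (subst (_ ∈_) eq (∈-filter⁺ P? y∈xs py)))
  where
  ∈-singleton : ∀ {y} → y ∈ x ∷ [] → y ≡ x
  ∈-singleton (here y≡x) = y≡x

-- Graphs and copies of K₄-e

module _ {v : ℕ} where

  open Graph using (neighbours)

  Adj? : (G : Graph v) (x y : Fin v) → Dec (Adj G x y)
  Adj? G x y = y ∈ₛ? lookup (neighbours G) x

  neighbours-injective : {G H : Graph v} → neighbours G ≡ neighbours H → G ≡ H
  neighbours-injective refl = refl

  _≟ᴳ_ : DecidableEquality (Graph v)
  G ≟ᴳ H = map′ neighbours-injective (cong neighbours) (≡-dec _≟ˢ_ (neighbours G) (neighbours H))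

  graph-ext : {G H : Graph v} → (∀ x y → Adj G x y ⇔ Adj H x y) → G ≡ H
  graph-ext {G} {H} eq = neighbours-injective
    (trans (sym (tabulate∘lookup _))
    (trans (tabulate-cong λ x → ⊆-antisym (λ {y} → to (eq x y)) (λ {y} → from (eq x y)))
           (tabulate∘lookup _)))

  -- The field `loopless` is irrelevant, so it is available only through irrelevant elimination of
  -- falsity.
  Adj-irrefl : (G : Graph v) (x : Fin v) → ¬ Adj G x x
  Adj-irrefl record { loopless = loopless } x Gxx = ⊥-elim-irr (loopless x Gxx)

  BlockAdj : (a b c d x y : Fin v) → Set
  BlockAdj a b c d x y = (x , y) ∈ K₄-e-edges a b c d ⊎ (y , x) ∈ K₄-e-edges a b c d

  BlockAdj? : ∀ a b c d x y → Dec (BlockAdj a b c d x y)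
  BlockAdj? a b c d x y = (x , y) ∈? K₄-e-edges a b c d ⊎-dec (y , x) ∈? K₄-e-edges a b c d
    where open DecMembership (×-≡-dec _≟_ _≟_)

  module _ {R : Fin v → Fin v → Set} (R? : ∀ x y → Dec (R x y)) where

    relationRows : Vec (Subset v) v
    relationRows = tabulate λ x → tabulate λ y → does (R? x y)

    lookup-relationRows : ∀ x y → lookup (lookup relationRows x) y ≡ does (R? x y)
    lookup-relationRows x y = trans (cong (λ r → lookup r y) (lookup∘tabulate _ x)) (lookup∘tabulate _ y)

    relationRows⇔ : ∀ x y → y ∈ₛ lookup relationRows x ⇔ R x y
    relationRows⇔ x y = mk⇔ sound complete
      where
      sound : y ∈ₛ lookup relationRows x → R x y
      sound y∈ with R? x y | trans (sym (lookup-relationRows x y)) ([]=⇒lookup y∈)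
      ... | yes r | _ = r
      complete : R x y → y ∈ₛ lookup relationRows x
      complete r = lookup⇒[]= y _ (trans (lookup-relationRows x y) (dec-true (R? x y) r))

  K₄-e-edges-loopless : ∀ {a b c d} → Unique (a ∷ b ∷ c ∷ d ∷ []) →
                        ∀ x → ¬ (x , x) ∈ K₄-e-edges {Fin v} a b c d
  K₄-e-edges-loopless ((a≢b ∷ _) ∷ _)         x (here refl)                             = a≢b refl
  K₄-e-edges-loopless ((_ ∷ a≢c ∷ _) ∷ _)     x (there (here refl))                     = a≢c refl
  K₄-e-edges-loopless ((_ ∷ _ ∷ a≢d ∷ _) ∷ _) x (there (there (here refl)))             = a≢d refl
  K₄-e-edges-loopless (_ ∷ (b≢c ∷ _) ∷ _)     x (there (there (there (here refl))))     = b≢c refl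
  K₄-e-edges-loopless (_ ∷ (_ ∷ b≢d ∷ _) ∷ _) x (there (there (there (there (here refl))))) = b≢d refl

  block : (a b c d : Fin v) → .(Unique (a ∷ b ∷ c ∷ d ∷ [])) → Graph v
  block a b c d u = record
    { neighbours = relationRows (BlockAdj? a b c d)
    ; symmetric  = λ x y → from (rows⇔ y x) ∘ swap ∘ to (rows⇔ x y)
    ; loopless   = λ x → reduce ∘ Sum.map (K₄-e-edges-loopless u x) (K₄-e-edges-loopless u x) ∘ to (rows⇔ x x)
    }
    where rows⇔ = relationRows⇔ (BlockAdj? a b c d)

  block-isBlockOn : ∀ {a b c d} (u : Unique (a ∷ b ∷ c ∷ d ∷ [])) → IsBlockOn (block a b c d u) a b c d
  block-isBlockOn {a} {b} {c} {d} u = record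
    { distinct = u ; adjacency = relationRows⇔ (BlockAdj? a b c d) }

  isBlockOn⇒≡block : ∀ {G a b c d} (B : IsBlockOn G a b c d) →
                     G ≡ block a b c d (IsBlockOn.distinct B)
  isBlockOn⇒≡block B = graph-ext λ x y → mk⇔
    (from (rows⇔ x y) ∘ to (IsBlockOn.adjacency B x y))
    (from (IsBlockOn.adjacency B x y) ∘ to (rows⇔ x y))
    where rows⇔ = relationRows⇔ (BlockAdj? _ _ _ _)

  open DecUnique (_≟_ {v}) using (unique?)

  blockIfDistinct : Fin v × Fin v × Fin v × Fin v → List (Graph v)
  blockIfDistinct (a , b , c , d) with unique? (a ∷ b ∷ c ∷ d ∷ [])
  ... | yes u = block a b c d u ∷ []
  ... | no  _ = []

  ∈-blockIfDistinct : ∀ {a b c d} (u : Unique (a ∷ b ∷ c ∷ d ∷ [])) →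
                      block a b c d u ∈ blockIfDistinct (a , b , c , d)
  ∈-blockIfDistinct {a} {b} {c} {d} u with unique? (a ∷ b ∷ c ∷ d ∷ [])
  ... | yes _ = here refl
  ... | no ¬u = contradiction u ¬u

  blockIfDistinct-copies : ∀ q → All IsK₄-e (blockIfDistinct q)
  blockIfDistinct-copies (a , b , c , d) with unique? (a ∷ b ∷ c ∷ d ∷ [])
  ... | yes u = (a , b , c , d , block-isBlockOn u) ∷ []
  ... | no  _ = []

  -- Swapping a with b, or c with d, gives the same graph, so each copy arises from four quadruples.
  -- Without deduplication the search would repeat every branch.
  allBlocks : List (Graph v)
  allBlocks = deduplicate _≟ᴳ_ (concatMap blockIfDistinct
    (cartesianProduct (allFin v) (cartesianProduct (allFin v) (cartesianProduct (allFin v) (allFin v)))))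

  ∈-allBlocks : ∀ {G} → IsK₄-e G → G ∈ allBlocks
  ∈-allBlocks (a , b , c , d , B) = ∈-deduplicate⁺ _≟ᴳ_ (∈-concatMap⁺ blockIfDistinct (lose
    (∈-cartesianProduct⁺ (∈-allFin a) (∈-cartesianProduct⁺ (∈-allFin b)
      (∈-cartesianProduct⁺ (∈-allFin c) (∈-allFin d))))
    (subst (_∈ blockIfDistinct (a , b , c , d)) (sym (isBlockOn⇒≡block B))
      (∈-blockIfDistinct (IsBlockOn.distinct B)))))

  -- Exact-cover search

  Covers : List (Graph v) → Fin v × Fin v → Set
  Covers Bs (x , y) = Any (λ B → Adj B x y) Bs

  covers? : ∀ Bs → Decidable (Covers Bs)
  covers? Bs (x , y) = Any.any? (λ B → Adj? B x y) Bs

  EdgeDisjoint : Graph v → Graph v → Set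
  EdgeDisjoint B C = ∀ x y → Adj B x y → ¬ Adj C x y

  Admissible : List (Graph v) → Fin v × Fin v → Graph v → Set
  Admissible Bs (x , y) B = Adj B x y × All (EdgeDisjoint B) Bs

  admissible? : ∀ Bs e → Decidable (Admissible Bs e)
  admissible? Bs (x , y) B = Adj? B x y ×-dec
    All.all? (λ C → all? λ x → all? λ y → Adj? B x y →-dec ¬? (Adj? C x y)) Bs

  -- The list 𝓑 of all blocks is an argument so that evaluation shares it.
  exactCovers : List (Graph v) → List (Graph v) → List (Fin v × Fin v) → List (List (Graph v))
  exactCovers 𝓑 Bs []       = Bs ∷ []
  exactCovers 𝓑 Bs (e ∷ es) =
    if does (covers? Bs e) then exactCovers 𝓑 Bs es
    else concatMap (λ B → exactCovers 𝓑 (B ∷ Bs) es) (filter (admissible? Bs e) 𝓑)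

  -- Each edge occurs in both orders; by symmetry of adjacency, the later one is already covered
  -- when the search reaches it.
  edges : List (Fin v × Fin v)
  edges = filter (λ (x , y) → ¬? (x ≟ y)) (cartesianProduct (allFin v) (allFin v))

  -- Triangles of a list of blocks

  IsTriangle : List (Graph v) → Pred (Subset v) 0ℓ
  IsTriangle Bs p = Any (λ B → T B p) Bs

  T? : ∀ B → Decidable (T {v} B)
  T? B p = ∣ p ∣ ≟ⁿ 3 ×-dec
    all? λ x → all? λ y → x ∈ₛ? p →-dec y ∈ₛ? p →-dec ¬? (x ≟ y) →-dec Adj? B x y

  isTriangle? : ∀ Bs → Decidable (IsTriangle Bs)
  isTriangle? Bs p = Any.any? (λ B → T? B p) Bs

  triangles : List (Graph v) → List (Subset v)
  triangles Bs = filter (isTriangle? Bs) (subsets v)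

  triangles-unique : ∀ Bs → Unique (triangles Bs)
  triangles-unique Bs = Unique.filter⁺ (isTriangle? Bs) (subsets-unique v)

  -- Completeness of the search

  module _ (D : Design v) where
    open Design D using (blocks; copies; partition)

    adjacent⇒≡ : ∀ {B C x y} → x ≢ y → B ∈ blocks → C ∈ blocks → Adj B x y → Adj C x y → B ≡ C
    adjacent⇒≡ x≢y B∈ C∈ Bxy Cxy =
      let (_ , _ , only) = partition _ _ x≢y in trans (sym (only (B∈ , Bxy))) (only (C∈ , Cxy))

    blocks⇒disjoint : ∀ {B C} → B ∈ blocks → C ∈ blocks → B ≢ C → EdgeDisjoint B C
    blocks⇒disjoint {B} B∈ C∈ B≢C x y Bxy Cxy with x ≟ y
    ... | yes refl = Adj-irrefl B x Bxy
    ... | no x≢y   = B≢C (adjacent⇒≡ x≢y B∈ C∈ Bxy Cxy)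

    -- Follows the branch that takes, at each uncovered pair, the design's own block through it.
    -- `Bs ⊆ Cs` carries coverage obtained on the way to the end of the branch.
    exactCovers-complete :
      ∀ {Bs es} → All (_∈ blocks) Bs → All (uncurry _≢_) es →
      ∃[ Cs ] Cs ∈ exactCovers allBlocks Bs es × All (_∈ blocks) Cs × Bs ⊆ Cs × All (Covers Cs) es
    exactCovers-complete {Bs} Bs⊆ [] = Bs , here refl , Bs⊆ , id , []
    exactCovers-complete {Bs} {(x , y) ∷ es} Bs⊆ (x≢y ∷ es≢) with covers? Bs (x , y)
    ... | yes cov =
      let (Cs , Cs∈ , Cs⊆ , Bs⊆Cs , covs) = exactCovers-complete Bs⊆ es≢
      in  Cs , Cs∈ , Cs⊆ , Bs⊆Cs , Any-resp-⊆ Bs⊆Cs cov ∷ covs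
    ... | no ¬cov =
      let (B , (B∈ , Bxy) , _)             = partition x y x≢y
          disjoint                         = All.tabulate λ C∈Bs →
            -- Were `B` among the chosen blocks, the pair would already be covered.
            blocks⇒disjoint B∈ (All.lookup Bs⊆ C∈Bs) λ { refl → ¬cov (lose C∈Bs Bxy) }
          (Cs , Cs∈ , Cs⊆ , BBs⊆Cs , covs) = exactCovers-complete (B∈ ∷ Bs⊆) es≢
      in  Cs
        , ∈-concatMap⁺ _ (lose
            (∈-filter⁺ (admissible? Bs (x , y)) (∈-allBlocks (All.lookup copies B∈)) (Bxy , disjoint))
            Cs∈)
        , Cs⊆ , BBs⊆Cs ∘ there , lose (BBs⊆Cs (here refl)) Bxy ∷ covs

    blocks∈exactCovers :
      ∃[ Cs ] Cs ∈ exactCovers allBlocks [] edges × (∀ B → B ∈ Cs ⇔ Blocks D B)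
    blocks∈exactCovers =
      let (Cs , Cs∈ , Cs⊆ , _ , covs) = exactCovers-complete []
            (all-filter (λ (x , y) → ¬? (x ≟ y)) (cartesianProduct (allFin v) (allFin v)))
      in  Cs , Cs∈ , λ B → mk⇔ (All.lookup Cs⊆) (blocks⊆ Cs⊆ covs)
      where
      blocks⊆ : ∀ {Cs} → All (_∈ blocks) Cs → All (Covers Cs) edges → blocks ⊆ Cs
      blocks⊆ {Cs} Cs⊆ covs B∈ =
        -- One edge identifies a block: the member of `Cs` covering ab is a block of the design
        -- through ab, hence the given one.
        let (a , b , _ , _ , isBlock) = All.lookup copies B∈
            a≢b = All.head (AllPairs.head (IsBlockOn.distinct isBlock))
            (C , C∈ , Cab) = find (All.lookup covs
              (∈-filter⁺ _ (∈-cartesianProduct⁺ (∈-allFin a) (∈-allFin b)) a≢b))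
            Bab = from (IsBlockOn.adjacency isBlock a b) (inj₁ (here refl))
        in  subst (_∈ Cs) (adjacent⇒≡ a≢b (All.lookup Cs⊆ C∈) B∈ Cab Bab) C∈

    ∈-triangles : ∀ {Bs} → (∀ B → B ∈ Bs ⇔ Blocks D B) → ∀ p → p ∈ triangles Bs ⇔ Triangles D p
    ∈-triangles {Bs} Bs⇔ p = mk⇔
      (λ p∈ → let (B , B∈ , TBp) = find (proj₂ (∈-filter⁻ (isTriangle? Bs) {xs = subsets v} p∈))
              in  B , to (Bs⇔ B) B∈ , TBp)
      (λ (B , B∈ , TBp) → ∈-filter⁺ (isTriangle? Bs) (∈-subsets p) (lose (from (Bs⇔ B) B∈) TBp))

  -- Designs from explicit quadruples

  blockList : List (Fin v × Fin v × Fin v × Fin v) → List (Graph v)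
  blockList = concatMap blockIfDistinct

  EdgesCoveredOnce : List (Graph v) → Set
  EdgesCoveredOnce Bs = ∀ x y → x ≢ y → length (filter (λ B → Adj? B x y) Bs) ≡ 1

  edgesCoveredOnce? : Decidable EdgesCoveredOnce
  edgesCoveredOnce? Bs =
    all? λ x → all? λ y → ¬? (x ≟ y) →-dec length (filter (λ B → Adj? B x y) Bs) ≟ⁿ 1

  design : ∀ qs → Unique (blockList qs) → EdgesCoveredOnce (blockList qs) → Design v
  design qs unique once = record
    { blocks    = blockList qs
    ; unique    = unique
    ; copies    = concat⁺ (map⁺ (All.universal blockIfDistinct-copies qs))
    ; partition = λ x y x≢y → unique-filter⇒∃! (λ B → Adj? B x y) (blockList qs) (once x y x≢y)
    }

-- Evaluation over all designs of order 6

System : ℕ → Set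
System v = List (Graph v) × List (Subset v)

withTriangles : ∀ {v} → List (Graph v) → System v
withTriangles Bs = Bs , triangles Bs

-- The triangles are stored with the blocks so that evaluation computes them
-- once per system rather than once per pair of systems.
systems : ∀ v → List (System v)
systems v = map withTriangles (exactCovers allBlocks [] edges)

-- Lists are compared by membership, since the search may find the blocks in another order than the
-- design lists them.
_Represents_ : ∀ {v} → System v → Design v → Set
(Bs , ps) Represents D = (∀ B → B ∈ Bs ⇔ Blocks D B) × (∀ p → p ∈ ps ⇔ Triangles D p) × Unique ps

system-of : ∀ {v} (D : Design v) → ∃[ S ] S ∈ systems v × S Represents D
system-of D =
  let (Bs , Bs∈ , Bs⇔) = blocks∈exactCovers D
  in  withTriangles Bs , ∈-map⁺ withTriangles Bs∈ , Bs⇔ , ∈-triangles D Bs⇔ , triangles-unique Bs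

intersection : ∀ {v} → System v → System v → ℕ × ℕ
intersection (Bs , ps) (Cs , qs) = common _≟ᴳ_ Bs Cs , common _≟ˢ_ ps qs

-- The second coordinate counts all common triangles, so (3 , 6) here stands for the pair (3 , 0) of
-- `Adm 6`.
spectrum : List (ℕ × ℕ)
spectrum = (0 , 0) ∷ (0 , 2) ∷ (0 , 3) ∷ (3 , 6) ∷ []

open DecMembership (×-≡-dec _≟ⁿ_ _≟ⁿ_) using () renaming (_∈?_ to _∈²?_)
open DecMembership _≟ⁿ_ using () renaming (_∈?_ to _∈ℕ?_)
open DecUnique (_≟ᴳ_ {6}) using () renaming (unique? to uniqueᴳ?)

AllPairsInSpectrum : List (System 6) → Set
AllPairsInSpectrum Ss = All (λ S → All (λ S′ → intersection S S′ ∈ spectrum) Ss) Ss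

-- Abstracting over Ss lets evaluation share the list; with the constant
-- systems 6 in its place, the search would be repeated for every S.
allPairsInSpectrum? : Decidable AllPairsInSpectrum
allPairsInSpectrum? Ss = All.all? (λ S → All.all? (λ S′ → intersection S S′ ∈²? spectrum) Ss) Ss

-- Makes the number of common blocks found by filtering a cardinality.
systems-unique : All (λ (Bs , _) → Unique Bs) (systems 6)
systems-unique = from-yes (All.all? (λ (Bs , _) → uniqueᴳ? Bs) (systems 6))

systems-intersection : AllPairsInSpectrum (systems 6)
systems-intersection = toWitness {a? = allPairsInSpectrum? (systems 6)} _

-- Opaque, lest uses of the result unfold the search behind systems 6.
opaque
  design-intersection :
    (D₁ D₂ : Design 6) →
    ∃[ s ] ∃[ t ] (s , t) ∈ spectrum × IntersectInBlocks D₁ D₂ s × IntersectInTriangles D₁ D₂ t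
  design-intersection D₁ D₂ =
    let ((Bs , ps) , S∈  , Bs⇔ , ps⇔ , ps-unique) = system-of D₁
        ((Cs , qs) , S′∈ , Cs⇔ , qs⇔ , _)         = system-of D₂
    in  common _≟ᴳ_ Bs Cs , common _≟ˢ_ ps qs
      , All.lookup (All.lookup systems-intersection S∈) S′∈
      , HasCard-∩ _≟ᴳ_ (All.lookup systems-unique S∈) Bs⇔ Cs⇔
      , HasCard-∩ _≟ˢ_ ps-unique ps⇔ qs⇔

-- Explicit pairs of designs

-- The pairs ab, cd, ef are arranged in a directed 3-cycle: each block is the edge of one pair with
-- the four edges joining it to the next pair.
cycle : (a b c d e f : Fin 6) → List (Fin 6 × Fin 6 × Fin 6 × Fin 6)
cycle a b c d e f = (a , b , c , d) ∷ (c , d , e , f) ∷ (e , f , a , b) ∷ []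

-- Up to the names of the vertices, this is the only design of order 6.
cyclic : (a b c d e f : Fin 6) → let Bs = blockList (cycle a b c d e f) in
         {True (uniqueᴳ? Bs)} → {True (edgesCoveredOnce? Bs)} → Design 6
cyclic a b c d e f {u} {o} = design (cycle a b c d e f) (toWitness u) (toWitness o)

standard : Design 6
standard = cyclic (# 0) (# 1) (# 2) (# 3) (# 4) (# 5)

fineIntersection :
  (D₁ D₂ : Design 6) (s t : ℕ) →
  intersection (withTriangles (Design.blocks D₁)) (withTriangles (Design.blocks D₂)) ≡ (s , t + 2 * s) →
  FineInt 6 (s , t)
fineIntersection D₁ D₂ s t eq = D₁ , D₂
  , subst (IntersectInBlocks D₁ D₂) (cong proj₁ eq)
      (HasCard-∩ _≟ᴳ_ (Design.unique D₁) (λ _ → ⇔-id _) (λ _ → ⇔-id _))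
  , subst (IntersectInTriangles D₁ D₂) (cong proj₂ eq)
      (HasCard-∩ _≟ˢ_ (triangles-unique (Design.blocks D₁))
        (∈-triangles D₁ λ _ → ⇔-id _) (∈-triangles D₂ λ _ → ⇔-id _))

realisable : ∀ s t → s + t ≤ 3 → s ∈ map proj₁ spectrum → t + 2 * s ∈ map proj₂ spectrum →
             FineInt 6 (s , t)
realisable 0 0 _ _ _ =
  -- The same three pairs with the direction of the cycle reversed.
  fineIntersection standard (cyclic (# 0) (# 1) (# 4) (# 5) (# 2) (# 3)) 0 0 refl
realisable 0 1 _ _ t∈ = contradiction t∈ (from-no (1 ∈ℕ? map proj₂ spectrum))
realisable 0 2 _ _ _ =
  -- Only the pair 01 is kept; the common triangles are 012 and 234.
  fineIntersection standard (cyclic (# 0) (# 1) (# 2) (# 4) (# 3) (# 5)) 0 2 refl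
realisable 0 3 _ _ _ =
  -- No pair is kept; the common triangles are 012, 145 and 235.
  fineIntersection standard (cyclic (# 0) (# 2) (# 1) (# 4) (# 3) (# 5)) 0 3 refl
realisable 0 (suc (suc (suc (suc _)))) (s≤s (s≤s (s≤s ())))
realisable 1 _ _ s∈ _ = contradiction s∈ (from-no (1 ∈ℕ? map proj₁ spectrum))
realisable 2 _ _ s∈ _ = contradiction s∈ (from-no (2 ∈ℕ? map proj₁ spectrum))
realisable 3 0 _ _ _ = fineIntersection standard standard 3 0 refl
realisable 3 (suc _) (s≤s (s≤s (s≤s ())))
realisable (suc (suc (suc (suc _)))) _ (s≤s (s≤s (s≤s ())))

-- The two inclusions

-- The bound of `Adm 6` with 2s added to both sides, to match the total triangle count in
-- `spectrum`.
spectrum-bound : All (λ (s , t) → s + t ≤ 3 + 2 * s) spectrum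
spectrum-bound = from-yes (All.all? (λ (s , t) → s + t ≤? 3 + 2 * s) spectrum)

theorem4p3 : FineInt 6 ≐ Adm 6
theorem4p3 = fine⇒adm , adm⇒fine
  where
  fine⇒adm : ∀ {p} → FineInt 6 p → Adm 6 p
  fine⇒adm {s , t} (D₁ , D₂ , hs , ht) with design-intersection D₁ D₂
  ... | _ , _ , ∈spectrum , hs′ , ht′
    -- Cardinalities are unique, so (s , t + 2 * s) itself lies in `spectrum`.
    with refl ← HasCard-unique hs hs′ | refl ← HasCard-unique ht ht′ =
      +-cancelʳ-≤ (2 * s) (s + t) 3
        (subst (_≤ 3 + 2 * s) (sym (+-assoc s t (2 * s))) (All.lookup spectrum-bound ∈spectrum))
    , (D₁ , D₂ , hs) , (D₁ , D₂ , ht)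

  adm⇒fine : ∀ {p} → Adm 6 p → FineInt 6 p
  adm⇒fine {s , t} (s+t≤3 , (D₁ , D₂ , hs) , (E₁ , E₂ , ht)) =
    -- The witnesses for `J` and `J-T` may be different pairs of designs, so each contributes one
    -- coordinate only.
    let (_ , _ , ∈spectrum₁ , hs′ , _) = design-intersection D₁ D₂
        (_ , _ , ∈spectrum₂ , _ , ht′) = design-intersection E₁ E₂
    in  realisable s t s+t≤3
          (subst (_∈ _) (HasCard-unique hs′ hs) (∈-map⁺ proj₁ ∈spectrum₁))
          (subst (_∈ _) (HasCard-unique ht′ ht) (∈-map⁺ proj₂ ∈spectrum₂))
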